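{- If a logic $\mathcal L=\langle\mathbf{Fm},\vdash_{\mathcal L}\rangle$ is a consistent extension of $\mathcal{LB}$, then ${\vdash_{\mathcal L}}={\models_{\mathcal{LB}}}$.
   Context: $\mathbf{Fm}$ is the algebra of formulas (with universe $Fm$) over a countable set of variables in the language $\{\land,\lor,\otimes,\oplus,\neg\}$ ($\land,\lor,\otimes,\oplus$ binary, $\neg$ unary, no constants). A logic is a pair $\langle\mathbf{Fm},\vdash\rangle$ where $\vdash$ is the consequence relation of a structural (substitution-invariant) closure operator on $Fm$ (not assumed finitary). A logic is consistent if there are $\varphi,\psi\in Fm$ with $\varphi\nvdash\psi$. $\mathcal L$ is an extension of $\mathcal{LB}$ if $\Gamma\models_{\mathcal{LB}}\varphi$ implies $\Gamma\vdash_{\mathcal L}\varphi$ for all $\Gamma\cup\{\varphi\}\subseteq Fm$. $\mathcal{FOUR}$ is the algebra with universe $\{\mathsf f,\bot,\top,\mathsf t\}$ where $\land,\lor$ are meet and join of the lattice order $\leq_t$ with $\mathsf f <_t \bot,\top <_t \mathsf t$ ($\bot,\top$ $\leq_t$-incomparable), $\otimes,\oplus$ are meet and join of the lattice order $\leq_k$ with $\bot <_k \mathsf f,\mathsf t <_k \top$ ($\mathsf f,\mathsf t$ $\leq_k$-incomparable), and $\neg \mathsf f = \mathsf t$, $\neg\mathsf t=\mathsf f$, $\neg\bot=\bot$, $\neg\top=\top$. Let $\mathsf{Tr}=\{\top,\mathsf t\}$. $\mathcal{LB}=\langle\mathbf{Fm},\models_{\mathcal{LB}}\rangle$ is the logic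 given by: $\Gamma\models_{\mathcal{LB}}\varphi$ iff for every homomorphism $h:\mathbf{Fm}\to\mathcal{FOUR}$, $h[\Gamma]\subseteq \mathsf{Tr}$ implies $h(\varphi)\in\mathsf{Tr}$. -}

module Defs where

open import Data.Nat.Base using (ℕ)
open import Data.Product.Base using (_×_; _,_; ∃; ∃₂)
open import Function.Base using (_∘_)
open import Level using (Level; 0ℓ; Lift) renaming (suc to lsuc)
open import Relation.Binary.Core using (Rel)
open import Relation.Binary.Lattice.Structures using (IsLattice)
open import Relation.Binary.PropositionalEquality
  using (_≡_; refl; cong; trans; isEquivalence)
open import Relation.Unary using (Pred; _∈_; _∉_; _⊆_; _∪_; ｛_｝)

private
  variable
    a b ℓ : Level

record Algebra : Set₁ where
  infixr 7 _∧_ _⊗_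
  infixr 6 _∨_ _⊕_
  infix  8 ¬_
  field
    Carrier : Set
    _∧_     : Carrier → Carrier → Carrier
    _∨_     : Carrier → Carrier → Carrier
    _⊗_     : Carrier → Carrier → Carrier
    _⊕_     : Carrier → Carrier → Carrier
    ¬_      : Carrier → Carrier

record Hom (𝐀 𝐁 : Algebra) : Set where
  private
    module A = Algebra 𝐀
    module B = Algebra 𝐁
  field
    ⟦_⟧    : A.Carrier → B.Carrier
    ∧-homo : ∀ x y → ⟦ x A.∧ y ⟧ ≡ ⟦ x ⟧ B.∧ ⟦ y ⟧
    ∨-homo : ∀ x y → ⟦ x A.∨ y ⟧ ≡ ⟦ x ⟧ B.∨ ⟦ y ⟧
    ⊗-homo : ∀ x y → ⟦ x A.⊗ y ⟧ ≡ ⟦ x ⟧ B.⊗ ⟦ y ⟧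
    ⊕-homo : ∀ x y → ⟦ x A.⊕ y ⟧ ≡ ⟦ x ⟧ B.⊕ ⟦ y ⟧
    ¬-homo : ∀ x → ⟦ A.¬ x ⟧ ≡ B.¬ ⟦ x ⟧

open Hom public using (⟦_⟧)

_∘ₕ_ : ∀ {𝐀 𝐁 𝐂} → Hom 𝐁 𝐂 → Hom 𝐀 𝐁 → Hom 𝐀 𝐂
g ∘ₕ f = record
  { ⟦_⟧    = G.⟦_⟧ ∘ F.⟦_⟧
  ; ∧-homo = λ x y → trans (cong G.⟦_⟧ (F.∧-homo x y)) (G.∧-homo _ _)
  ; ∨-homo = λ x y → trans (cong G.⟦_⟧ (F.∨-homo x y)) (G.∨-homo _ _)
  ; ⊗-homo = λ x y → trans (cong G.⟦_⟧ (F.⊗-homo x y)) (G.⊗-homo _ _)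
  ; ⊕-homo = λ x y → trans (cong G.⟦_⟧ (F.⊕-homo x y)) (G.⊕-homo _ _)
  ; ¬-homo = λ x → trans (cong G.⟦_⟧ (F.¬-homo x)) (G.¬-homo _)
  }
  where
  module F = Hom f
  module G = Hom g

data Four : Set where
  𝖿 ⊥ ⊤ 𝗍 : Four

module Four-operations where

  infixr 7 _∧_ _⊗_
  infixr 6 _∨_ _⊕_
  infix  8 ¬_
  infix  4 _≤ₜ_ _≤ₖ_

  data _≤ₜ_ : Rel Four 0ℓ where
    reflₜ : ∀ {x} → x ≤ₜ x
    𝖿≤    : ∀ {x} → 𝖿 ≤ₜ x
    ≤𝗍    : ∀ {x} → x ≤ₜ 𝗍

  data _≤ₖ_ : Rel Four 0ℓ where
    reflₖ : ∀ {x} → x ≤ₖ x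
    ⊥≤    : ∀ {x} → ⊥ ≤ₖ x
    ≤⊤    : ∀ {x} → x ≤ₖ ⊤

  _∧_ _∨_ _⊗_ _⊕_ : Four → Four → Four

  𝖿 ∧ y = 𝖿
  𝗍 ∧ y = y
  ⊥ ∧ 𝖿 = 𝖿
  ⊥ ∧ ⊥ = ⊥
  ⊥ ∧ ⊤ = 𝖿
  ⊥ ∧ 𝗍 = ⊥
  ⊤ ∧ 𝖿 = 𝖿
  ⊤ ∧ ⊥ = 𝖿
  ⊤ ∧ ⊤ = ⊤
  ⊤ ∧ 𝗍 = ⊤

  𝖿 ∨ y = y
  𝗍 ∨ y = 𝗍
  ⊥ ∨ 𝖿 = ⊥
  ⊥ ∨ ⊥ = ⊥
  ⊥ ∨ ⊤ = 𝗍
  ⊥ ∨ 𝗍 = 𝗍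
  ⊤ ∨ 𝖿 = ⊤
  ⊤ ∨ ⊥ = 𝗍
  ⊤ ∨ ⊤ = ⊤
  ⊤ ∨ 𝗍 = 𝗍

  ⊥ ⊗ y = ⊥
  ⊤ ⊗ y = y
  𝖿 ⊗ 𝖿 = 𝖿
  𝖿 ⊗ ⊥ = ⊥
  𝖿 ⊗ ⊤ = 𝖿
  𝖿 ⊗ 𝗍 = ⊥
  𝗍 ⊗ 𝖿 = ⊥
  𝗍 ⊗ ⊥ = ⊥
  𝗍 ⊗ ⊤ = 𝗍
  𝗍 ⊗ 𝗍 = 𝗍

  ⊥ ⊕ y = y
  ⊤ ⊕ y = ⊤
  𝖿 ⊕ 𝖿 = 𝖿
  𝖿 ⊕ ⊥ = 𝖿
  𝖿 ⊕ ⊤ = ⊤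
  𝖿 ⊕ 𝗍 = ⊤
  𝗍 ⊕ 𝖿 = ⊤
  𝗍 ⊕ ⊥ = 𝗍
  𝗍 ⊕ ⊤ = ⊤
  𝗍 ⊕ 𝗍 = 𝗍

  ¬_ : Four → Four
  ¬ 𝖿 = 𝗍
  ¬ ⊥ = ⊥
  ¬ ⊤ = ⊤
  ¬ 𝗍 = 𝖿

  ≤ₜ-isLattice : IsLattice _≡_ _≤ₜ_ _∨_ _∧_
  ≤ₜ-isLattice = record
    { isPartialOrder = record
      { isPreorder = record
        { isEquivalence = isEquivalence
        ; reflexive = λ { refl → reflₜ }
        ; trans = ≤ₜ-trans }
      ; antisym = ≤ₜ-antisym }
    ; supremum = λ x y → x≤x∨y x y , y≤x∨y x y , λ _ → ∨-least
    ; infimum = λ x y → x∧y≤x x y , x∧y≤y x y , λ _ → ∧-greatest }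
    where
    ≤ₜ-trans : ∀ {x y z} → x ≤ₜ y → y ≤ₜ z → x ≤ₜ z
    ≤ₜ-trans reflₜ q = q
    ≤ₜ-trans 𝖿≤ q = 𝖿≤
    ≤ₜ-trans ≤𝗍 reflₜ = ≤𝗍
    ≤ₜ-trans ≤𝗍 ≤𝗍 = ≤𝗍

    ≤ₜ-antisym : ∀ {x y} → x ≤ₜ y → y ≤ₜ x → x ≡ y
    ≤ₜ-antisym reflₜ q = refl
    ≤ₜ-antisym 𝖿≤ reflₜ = refl
    ≤ₜ-antisym 𝖿≤ 𝖿≤ = refl
    ≤ₜ-antisym ≤𝗍 reflₜ = refl
    ≤ₜ-antisym ≤𝗍 ≤𝗍 = refl

    x≤x∨y : ∀ x y → x ≤ₜ x ∨ y
    x≤x∨y 𝖿 y = 𝖿≤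
    x≤x∨y ⊥ 𝖿 = reflₜ
    x≤x∨y ⊥ ⊥ = reflₜ
    x≤x∨y ⊥ ⊤ = ≤𝗍
    x≤x∨y ⊥ 𝗍 = ≤𝗍
    x≤x∨y ⊤ 𝖿 = reflₜ
    x≤x∨y ⊤ ⊥ = ≤𝗍
    x≤x∨y ⊤ ⊤ = reflₜ
    x≤x∨y ⊤ 𝗍 = ≤𝗍
    x≤x∨y 𝗍 y = ≤𝗍

    y≤x∨y : ∀ x y → y ≤ₜ x ∨ y
    y≤x∨y 𝖿 y = reflₜ
    y≤x∨y ⊥ 𝖿 = 𝖿≤
    y≤x∨y ⊥ ⊥ = reflₜ
    y≤x∨y ⊥ ⊤ = ≤𝗍
    y≤x∨y ⊥ 𝗍 = ≤𝗍
    y≤x∨y ⊤ 𝖿 = 𝖿≤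
    y≤x∨y ⊤ ⊥ = ≤𝗍
    y≤x∨y ⊤ ⊤ = reflₜ
    y≤x∨y ⊤ 𝗍 = ≤𝗍
    y≤x∨y 𝗍 y = ≤𝗍

    x∧y≤x : ∀ x y → x ∧ y ≤ₜ x
    x∧y≤x 𝖿 y = 𝖿≤
    x∧y≤x ⊥ 𝖿 = 𝖿≤
    x∧y≤x ⊥ ⊥ = reflₜ
    x∧y≤x ⊥ ⊤ = 𝖿≤
    x∧y≤x ⊥ 𝗍 = reflₜ
    x∧y≤x ⊤ 𝖿 = 𝖿≤
    x∧y≤x ⊤ ⊥ = 𝖿≤
    x∧y≤x ⊤ ⊤ = reflₜ
    x∧y≤x ⊤ 𝗍 = reflₜ
    x∧y≤x 𝗍 y = ≤𝗍

    x∧y≤y : ∀ x y → x ∧ y ≤ₜ y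
    x∧y≤y 𝖿 y = 𝖿≤
    x∧y≤y ⊥ 𝖿 = 𝖿≤
    x∧y≤y ⊥ ⊥ = reflₜ
    x∧y≤y ⊥ ⊤ = 𝖿≤
    x∧y≤y ⊥ 𝗍 = ≤𝗍
    x∧y≤y ⊤ 𝖿 = 𝖿≤
    x∧y≤y ⊤ ⊥ = 𝖿≤
    x∧y≤y ⊤ ⊤ = reflₜ
    x∧y≤y ⊤ 𝗍 = ≤𝗍
    x∧y≤y 𝗍 y = reflₜ

    ∨-least : ∀ {x y z} → x ≤ₜ z → y ≤ₜ z → x ∨ y ≤ₜ z
    ∨-least {𝖿} p q = q
    ∨-least {𝗍} p q = p
    ∨-least {⊥} {𝖿} p q = p
    ∨-least {⊥} {⊥} p q = q
    ∨-least {⊥} {⊤} ≤𝗍 q = ≤𝗍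
    ∨-least {⊥} {⊤} reflₜ ()
    ∨-least {⊥} {𝗍} p q = q
    ∨-least {⊤} {𝖿} p q = p
    ∨-least {⊤} {⊥} ≤𝗍 q = ≤𝗍
    ∨-least {⊤} {⊥} reflₜ ()
    ∨-least {⊤} {⊤} p q = q
    ∨-least {⊤} {𝗍} p q = q

    ∧-greatest : ∀ {x y z} → z ≤ₜ x → z ≤ₜ y → z ≤ₜ x ∧ y
    ∧-greatest {𝖿} p q = p
    ∧-greatest {𝗍} p q = q
    ∧-greatest {⊥} {𝖿} p q = q
    ∧-greatest {⊥} {⊥} p q = q
    ∧-greatest {⊥} {⊤} 𝖿≤ q = 𝖿≤
    ∧-greatest {⊥} {⊤} reflₜ ()
    ∧-greatest {⊥} {𝗍} p q = p
    ∧-greatest {⊤} {𝖿} p q = q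
    ∧-greatest {⊤} {⊥} 𝖿≤ q = 𝖿≤
    ∧-greatest {⊤} {⊥} reflₜ ()
    ∧-greatest {⊤} {⊤} p q = q
    ∧-greatest {⊤} {𝗍} p q = p

  ≤ₖ-isLattice : IsLattice _≡_ _≤ₖ_ _⊕_ _⊗_
  ≤ₖ-isLattice = record
    { isPartialOrder = record
      { isPreorder = record
        { isEquivalence = isEquivalence
        ; reflexive = λ { refl → reflₖ }
        ; trans = ≤ₖ-trans }
      ; antisym = ≤ₖ-antisym }
    ; supremum = λ x y → x≤x⊕y x y , y≤x⊕y x y , λ _ → ⊕-least
    ; infimum = λ x y → x⊗y≤x x y , x⊗y≤y x y , λ _ → ⊗-greatest }
    where
    ≤ₖ-trans : ∀ {x y z} → x ≤ₖ y → y ≤ₖ z → x ≤ₖ z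
    ≤ₖ-trans reflₖ q = q
    ≤ₖ-trans ⊥≤ q = ⊥≤
    ≤ₖ-trans ≤⊤ reflₖ = ≤⊤
    ≤ₖ-trans ≤⊤ ≤⊤ = ≤⊤

    ≤ₖ-antisym : ∀ {x y} → x ≤ₖ y → y ≤ₖ x → x ≡ y
    ≤ₖ-antisym reflₖ q = refl
    ≤ₖ-antisym ⊥≤ reflₖ = refl
    ≤ₖ-antisym ⊥≤ ⊥≤ = refl
    ≤ₖ-antisym ≤⊤ reflₖ = refl
    ≤ₖ-antisym ≤⊤ ≤⊤ = refl

    x≤x⊕y : ∀ x y → x ≤ₖ x ⊕ y
    x≤x⊕y ⊥ y = ⊥≤
    x≤x⊕y 𝖿 ⊥ = reflₖ
    x≤x⊕y 𝖿 𝖿 = reflₖ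
    x≤x⊕y 𝖿 𝗍 = ≤⊤
    x≤x⊕y 𝖿 ⊤ = ≤⊤
    x≤x⊕y 𝗍 ⊥ = reflₖ
    x≤x⊕y 𝗍 𝖿 = ≤⊤
    x≤x⊕y 𝗍 𝗍 = reflₖ
    x≤x⊕y 𝗍 ⊤ = ≤⊤
    x≤x⊕y ⊤ y = ≤⊤

    y≤x⊕y : ∀ x y → y ≤ₖ x ⊕ y
    y≤x⊕y ⊥ y = reflₖ
    y≤x⊕y 𝖿 ⊥ = ⊥≤
    y≤x⊕y 𝖿 𝖿 = reflₖ
    y≤x⊕y 𝖿 𝗍 = ≤⊤
    y≤x⊕y 𝖿 ⊤ = ≤⊤
    y≤x⊕y 𝗍 ⊥ = ⊥≤
    y≤x⊕y 𝗍 𝖿 = ≤⊤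
    y≤x⊕y 𝗍 𝗍 = reflₖ
    y≤x⊕y 𝗍 ⊤ = ≤⊤
    y≤x⊕y ⊤ y = ≤⊤

    x⊗y≤x : ∀ x y → x ⊗ y ≤ₖ x
    x⊗y≤x ⊥ y = ⊥≤
    x⊗y≤x 𝖿 ⊥ = ⊥≤
    x⊗y≤x 𝖿 𝖿 = reflₖ
    x⊗y≤x 𝖿 𝗍 = ⊥≤
    x⊗y≤x 𝖿 ⊤ = reflₖ
    x⊗y≤x 𝗍 ⊥ = ⊥≤
    x⊗y≤x 𝗍 𝖿 = ⊥≤
    x⊗y≤x 𝗍 𝗍 = reflₖ
    x⊗y≤x 𝗍 ⊤ = reflₖ
    x⊗y≤x ⊤ y = ≤⊤

    x⊗y≤y : ∀ x y → x ⊗ y ≤ₖ y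
    x⊗y≤y ⊥ y = ⊥≤
    x⊗y≤y 𝖿 ⊥ = ⊥≤
    x⊗y≤y 𝖿 𝖿 = reflₖ
    x⊗y≤y 𝖿 𝗍 = ⊥≤
    x⊗y≤y 𝖿 ⊤ = ≤⊤
    x⊗y≤y 𝗍 ⊥ = ⊥≤
    x⊗y≤y 𝗍 𝖿 = ⊥≤
    x⊗y≤y 𝗍 𝗍 = reflₖ
    x⊗y≤y 𝗍 ⊤ = ≤⊤
    x⊗y≤y ⊤ y = reflₖ

    ⊕-least : ∀ {x y z} → x ≤ₖ z → y ≤ₖ z → x ⊕ y ≤ₖ z
    ⊕-least {⊥} p q = q
    ⊕-least {⊤} p q = p
    ⊕-least {𝖿} {⊥} p q = p
    ⊕-least {𝖿} {𝖿} p q = q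
    ⊕-least {𝖿} {𝗍} ≤⊤ q = ≤⊤
    ⊕-least {𝖿} {𝗍} reflₖ ()
    ⊕-least {𝖿} {⊤} p q = q
    ⊕-least {𝗍} {⊥} p q = p
    ⊕-least {𝗍} {𝖿} ≤⊤ q = ≤⊤
    ⊕-least {𝗍} {𝖿} reflₖ ()
    ⊕-least {𝗍} {𝗍} p q = q
    ⊕-least {𝗍} {⊤} p q = q

    ⊗-greatest : ∀ {x y z} → z ≤ₖ x → z ≤ₖ y → z ≤ₖ x ⊗ y
    ⊗-greatest {⊥} p q = p
    ⊗-greatest {⊤} p q = q
    ⊗-greatest {𝖿} {⊥} p q = q
    ⊗-greatest {𝖿} {𝖿} p q = q
    ⊗-greatest {𝖿} {𝗍} ⊥≤ q = ⊥≤
    ⊗-greatest {𝖿} {𝗍} reflₖ ()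
    ⊗-greatest {𝖿} {⊤} p q = p
    ⊗-greatest {𝗍} {⊥} p q = q
    ⊗-greatest {𝗍} {𝖿} ⊥≤ q = ⊥≤
    ⊗-greatest {𝗍} {𝖿} reflₖ ()
    ⊗-greatest {𝗍} {𝗍} p q = q
    ⊗-greatest {𝗍} {⊤} p q = p

open Four-operations using (_≤ₜ_; _≤ₖ_; ≤ₜ-isLattice; ≤ₖ-isLattice) public

𝓕𝓞𝓤𝓡 : Algebra
𝓕𝓞𝓤𝓡 = record { Carrier = Four ; Four-operations }

data Fm : Set where
  var             : ℕ → Fm
  _∧_ _∨_ _⊗_ _⊕_ : Fm → Fm → Fm
  ¬_              : Fm → Fm

infixr 7 _∧_ _⊗_
infixr 6 _∨_ _⊕_
infix  8 ¬_

𝐅𝐦 : Algebra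
𝐅𝐦 = record
  { Carrier = Fm ; _∧_ = _∧_ ; _∨_ = _∨_ ; _⊗_ = _⊗_ ; _⊕_ = _⊕_ ; ¬_ = ¬_ }

Substitution : Set
Substitution = Hom 𝐅𝐦 𝐅𝐦

_[_] : {A : Set a} {B : Set b} → (A → B) → Pred A ℓ → Pred B _
(f [ P ]) y = ∃ λ x → x ∈ P × f x ≡ y

-- Subsets of Fm are predicates in an arbitrary but fixed universe ℓ.
record Logic ℓ : Set (lsuc ℓ) where
  infix 4 _⊢_ _⊬_
  field
    Cn         : Pred Fm ℓ → Pred Fm ℓ
    extensive  : ∀ {Γ} → Γ ⊆ Cn Γ
    monotone   : ∀ {Γ Δ} → Γ ⊆ Δ → Cn Γ ⊆ Cn Δ
    idempotent : ∀ {Γ} → Cn (Cn Γ) ⊆ Cn Γ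
    structural : ∀ (σ : Substitution) {Γ} → ⟦ σ ⟧ [ Cn Γ ] ⊆ Cn (⟦ σ ⟧ [ Γ ])

  _⊢_ _⊬_ : Pred Fm ℓ → Fm → Set ℓ
  Γ ⊢ φ = φ ∈ Cn Γ
  Γ ⊬ φ = φ ∉ Cn Γ

Consistent : Logic ℓ → Set ℓ
Consistent {ℓ} 𝓛 = ∃₂ λ φ ψ → (λ χ → Lift ℓ (χ ∈ ｛ φ ｝)) ⊬ ψ
  where open Logic 𝓛

_Extends_ : Logic ℓ → Logic ℓ → Set (lsuc ℓ)
𝓛 Extends 𝓜 = ∀ Γ φ → Γ M.⊢ φ → Γ L.⊢ φ
  where
  module L = Logic 𝓛
  module M = Logic 𝓜

Tr : Pred Four 0ℓ
Tr = ｛ ⊤ ｝ ∪ ｛ 𝗍 ｝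

infix 4 _⊨_

_⊨_ : Pred Fm ℓ → Fm → Set ℓ
Γ ⊨ φ = (h : Hom 𝐅𝐦 𝓕𝓞𝓤𝓡) → ⟦ h ⟧ [ Γ ] ⊆ Tr → ⟦ h ⟧ φ ∈ Tr

𝓛𝓑 : ∀ {ℓ} → Logic ℓ
𝓛𝓑 = record
  { Cn         = λ Γ φ → Γ ⊨ φ
  ; extensive  = λ γ∈Γ h hΓ⊆Tr → hΓ⊆Tr (_ , γ∈Γ , refl)
  ; monotone   = λ Γ⊆Δ Γ⊨φ h hΔ⊆Tr →
                   Γ⊨φ h λ { (γ , γ∈Γ , eq) → hΔ⊆Tr (γ , Γ⊆Δ γ∈Γ , eq) }
  ; idempotent = λ CnΓ⊨φ h hΓ⊆Tr →
                   CnΓ⊨φ h λ { (γ , Γ⊨γ , refl) → Γ⊨γ h hΓ⊆Tr }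
  ; structural = λ { σ (φ , Γ⊨φ , refl) h hσΓ⊆Tr →
                   Γ⊨φ (h ∘ₕ σ) λ { (γ , γ∈Γ , refl) →
                     hσΓ⊆Tr (_ , (γ , γ∈Γ , refl) , refl) } }
  }

{-# OPTIONS --safe #-}

-- Suppose Γ ⊢ φ but h[Γ] ⊆ Tr and h(φ) ∉ Tr for some h. Given formulas ψ and χ, the four terms
-- ψ ⊕ ¬ψ, χ ⊗ ¬χ and their ∨ and ∧ take the values ⊤, ⊥, 𝗍, 𝖿 under every valuation with
-- ψ ∈ Tr and χ ∉ Tr. Let σ send each variable x to the term naming h(x). A valuation g with
-- g(ψ) ∈ Tr then satisfies g ∘ σ = h, unless g(χ) = ⊤, when g ∘ σ is constantly ⊤. Either way σ[Γ]
-- holds under g, so ψ ⊢ σφ; and ψ, σφ ⊨ χ because g(χ) ∉ Tr would give g(σφ) = h(φ) ∉ Tr.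
-- Hence ψ ⊢ χ for all ψ and χ, contradicting consistency.
module Submission where

open import Data.Empty using (⊥-elim)
open import Data.Nat.Base using (ℕ)
open import Data.Product.Base using (_,_)
open import Data.Sum.Base using (_⊎_; inj₁; inj₂)
open import Defs
open import Function.Base using (_∘_)
open import Function.Bundles using (_⇔_; mk⇔)
open import Level using (Level; Lift; lift)
open import Relation.Binary.PropositionalEquality
  using (_≡_; refl; sym; trans; cong; cong₂; subst; module ≡-Reasoning)
open import Relation.Nullary.Decidable using (yes; no)
open import Relation.Unary using (Pred; Decidable; _∈_; _∉_; _⊆_; ｛_｝)

private
  variable
    ℓ : Level
    𝐀 𝐁 : Algebra

module _ {𝐁 : Algebra} where

  private module B = Algebra 𝐁

  extend : (ℕ → B.Carrier) → Hom 𝐅𝐦 𝐁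
  extend v = record
    { ⟦_⟧    = ⟦_⟧ᵥ
    ; ∧-homo = λ _ _ → refl
    ; ∨-homo = λ _ _ → refl
    ; ⊗-homo = λ _ _ → refl
    ; ⊕-homo = λ _ _ → refl
    ; ¬-homo = λ _ → refl
    }
    where
    ⟦_⟧ᵥ : Fm → B.Carrier
    ⟦ var n ⟧ᵥ = v n
    ⟦ φ ∧ ψ ⟧ᵥ = ⟦ φ ⟧ᵥ B.∧ ⟦ ψ ⟧ᵥ
    ⟦ φ ∨ ψ ⟧ᵥ = ⟦ φ ⟧ᵥ B.∨ ⟦ ψ ⟧ᵥ
    ⟦ φ ⊗ ψ ⟧ᵥ = ⟦ φ ⟧ᵥ B.⊗ ⟦ ψ ⟧ᵥ
    ⟦ φ ⊕ ψ ⟧ᵥ = ⟦ φ ⟧ᵥ B.⊕ ⟦ ψ ⟧ᵥ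
    ⟦ ¬ φ ⟧ᵥ   = B.¬ ⟦ φ ⟧ᵥ

  hom-unique : (g h : Hom 𝐅𝐦 𝐁) → (∀ n → ⟦ g ⟧ (var n) ≡ ⟦ h ⟧ (var n)) →
               ∀ φ → ⟦ g ⟧ φ ≡ ⟦ h ⟧ φ
  hom-unique g h g≗h = go
    where
    module G = Hom g
    module H = Hom h
    go : ∀ φ → ⟦ g ⟧ φ ≡ ⟦ h ⟧ φ
    go (var n) = g≗h n
    go (φ ∧ ψ) = trans (G.∧-homo φ ψ) (trans (cong₂ B._∧_ (go φ) (go ψ)) (sym (H.∧-homo φ ψ)))
    go (φ ∨ ψ) = trans (G.∨-homo φ ψ) (trans (cong₂ B._∨_ (go φ) (go ψ)) (sym (H.∨-homo φ ψ)))
    go (φ ⊗ ψ) = trans (G.⊗-homo φ ψ) (trans (cong₂ B._⊗_ (go φ) (go ψ)) (sym (H.⊗-homo φ ψ)))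
    go (φ ⊕ ψ) = trans (G.⊕-homo φ ψ) (trans (cong₂ B._⊕_ (go φ) (go ψ)) (sym (H.⊕-homo φ ψ)))
    go (¬ φ)   = trans (G.¬-homo φ) (trans (cong B.¬_ (go φ)) (sym (H.¬-homo φ)))

-- `⊤` is fixed by `¬` and idempotent for the four binary operations, so it forms a one-element
-- subalgebra.
constant-⊤ : Hom 𝐀 𝓕𝓞𝓤𝓡
constant-⊤ = record
  { ⟦_⟧    = λ _ → ⊤
  ; ∧-homo = λ _ _ → refl
  ; ∨-homo = λ _ _ → refl
  ; ⊗-homo = λ _ _ → refl
  ; ⊕-homo = λ _ _ → refl
  ; ¬-homo = λ _ → refl
  }

module _ (𝐀 : Algebra) (x y : Algebra.Carrier 𝐀) where

  private module A = Algebra 𝐀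

  -- Stated over any algebra, so that one term is read both as a formula in `𝐅𝐦` and as a value in
  -- `𝓕𝓞𝓤𝓡`; `name-homo` links the two readings.
  name : Four → A.Carrier
  name ⊤ = x A.⊕ A.¬ x
  name ⊥ = y A.⊗ A.¬ y
  name 𝗍 = name ⊤ A.∨ name ⊥
  name 𝖿 = name ⊤ A.∧ name ⊥

name-homo : (h : Hom 𝐀 𝐁) → ∀ x y a →
            ⟦ h ⟧ (name 𝐀 x y a) ≡ name 𝐁 (⟦ h ⟧ x) (⟦ h ⟧ y) a
name-homo {𝐁 = 𝐁} h x y = go
  where
  module B = Algebra 𝐁
  module H = Hom h
  go : ∀ a → _
  go ⊤ = trans (H.⊕-homo _ _) (cong (_ B.⊕_) (H.¬-homo x))
  go ⊥ = trans (H.⊗-homo _ _) (cong (_ B.⊗_) (H.¬-homo y))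
  go 𝗍 = trans (H.∨-homo _ _) (cong₂ B._∨_ (go ⊤) (go ⊥))
  go 𝖿 = trans (H.∧-homo _ _) (cong₂ B._∧_ (go ⊤) (go ⊥))

Tr? : Decidable Tr
Tr? ⊤ = yes (inj₁ refl)
Tr? 𝗍 = yes (inj₂ refl)
Tr? 𝖿 = no λ { (inj₁ ()) ; (inj₂ ()) }
Tr? ⊥ = no λ { (inj₁ ()) ; (inj₂ ()) }

name-⊤ : ∀ {p} q → p ∈ Tr → name 𝓕𝓞𝓤𝓡 p q ⊤ ≡ ⊤
name-⊤ _ (inj₁ refl) = refl
name-⊤ _ (inj₂ refl) = refl

-- Only the two generators need checking: `⊤ ∨ ⊥` is `𝗍` and `⊤ ∧ ⊥` is `𝖿`.
name-faithful : ∀ {p} q → p ∈ Tr → name 𝓕𝓞𝓤𝓡 p q ⊥ ≡ ⊥ → ∀ a → name 𝓕𝓞𝓤𝓡 p q a ≡ a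
name-faithful q p∈Tr ⊥-eq = λ where
    ⊤ → name-⊤ q p∈Tr
    ⊥ → ⊥-eq
    𝗍 → cong₂ F._∨_ (name-⊤ q p∈Tr) ⊥-eq
    𝖿 → cong₂ F._∧_ (name-⊤ q p∈Tr) ⊥-eq
  where module F = Algebra 𝓕𝓞𝓤𝓡

name-constant : ∀ {p} → p ∈ Tr → ∀ a → name 𝓕𝓞𝓤𝓡 p ⊤ a ≡ ⊤
name-constant p∈Tr = λ where
    ⊤ → name-⊤ ⊤ p∈Tr
    ⊥ → refl
    𝗍 → cong (F._∨ ⊤) (name-⊤ ⊤ p∈Tr)
    𝖿 → cong (F._∧ ⊤) (name-⊤ ⊤ p∈Tr)
  where module F = Algebra 𝓕𝓞𝓤𝓡

-- Both `𝖿 ⊗ 𝗍` and `⊥ ⊗ ⊥` are `⊥`, so `⊤` is the only bad value. The split is thus at `q ≡ ⊤` and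
-- not at `q ∈ Tr`: the value `𝗍` is good as well.
name-⊥ : ∀ q → q ≡ ⊤ ⊎ (∀ p → name 𝓕𝓞𝓤𝓡 p q ⊥ ≡ ⊥)
name-⊥ ⊤ = inj₁ refl
name-⊥ 𝖿 = inj₂ λ _ → refl
name-⊥ ⊥ = inj₂ λ _ → refl
name-⊥ 𝗍 = inj₂ λ _ → refl

naming : Hom 𝐅𝐦 𝓕𝓞𝓤𝓡 → Fm → Fm → Substitution
naming h ψ χ = extend (name 𝐅𝐦 ψ χ ∘ ⟦ h ⟧ ∘ var)

naming-value : ∀ h ψ χ (g : Hom 𝐅𝐦 𝓕𝓞𝓤𝓡) → ⟦ g ⟧ ψ ∈ Tr →
               ⟦ g ⟧ χ ≡ ⊤ ⊎ (∀ φ → ⟦ g ⟧ (⟦ naming h ψ χ ⟧ φ) ≡ ⟦ h ⟧ φ)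
naming-value h ψ χ g gψ∈Tr with name-⊥ (⟦ g ⟧ χ)
... | inj₁ gχ≡⊤ = inj₁ gχ≡⊤
... | inj₂ ⊥-eq = inj₂ (hom-unique (g ∘ₕ naming h ψ χ) h λ n →
  trans (name-homo g ψ χ (⟦ h ⟧ (var n)))
        (name-faithful (⟦ g ⟧ χ) gψ∈Tr (⊥-eq (⟦ g ⟧ ψ)) (⟦ h ⟧ (var n))))

naming-constant : ∀ h ψ χ (g : Hom 𝐅𝐦 𝓕𝓞𝓤𝓡) → ⟦ g ⟧ ψ ∈ Tr → ⟦ g ⟧ χ ≡ ⊤ →
                  ∀ φ → ⟦ g ⟧ (⟦ naming h ψ χ ⟧ φ) ≡ ⊤
naming-constant h ψ χ g gψ∈Tr gχ≡⊤ = hom-unique (g ∘ₕ naming h ψ χ) constant-⊤ λ n →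
  let a = ⟦ h ⟧ (var n) in begin
    ⟦ g ⟧ (name 𝐅𝐦 ψ χ a)               ≡⟨ name-homo g ψ χ a ⟩
    name 𝓕𝓞𝓤𝓡 (⟦ g ⟧ ψ) (⟦ g ⟧ χ) a  ≡⟨ cong (λ q → name 𝓕𝓞𝓤𝓡 (⟦ g ⟧ ψ) q a) gχ≡⊤ ⟩
    name 𝓕𝓞𝓤𝓡 (⟦ g ⟧ ψ) ⊤ a          ≡⟨ name-constant gψ∈Tr a ⟩
    ⊤                                   ∎
  where open ≡-Reasoning

module _ (h : Hom 𝐅𝐦 𝓕𝓞𝓤𝓡) (ψ χ : Fm) {Δ : Pred Fm ℓ} (ψ∈Δ : ψ ∈ Δ) where

  -- `Δ` is any set containing `ψ`, because two choices occur later: the singleton of `ψ` here, and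
  -- its closure under `Cn` in `naming-explosive`.
  naming-sound : ∀ {γ} → ⟦ h ⟧ γ ∈ Tr → Δ ⊨ ⟦ naming h ψ χ ⟧ γ
  naming-sound {γ} hγ∈Tr g gΔ⊆Tr with naming-value h ψ χ g (gΔ⊆Tr (ψ , ψ∈Δ , refl))
  ... | inj₂ gσ≗h = subst Tr (sym (gσ≗h γ)) hγ∈Tr
  ... | inj₁ gχ≡⊤ =
    inj₁ (sym (naming-constant h ψ χ g (gΔ⊆Tr (ψ , ψ∈Δ , refl)) gχ≡⊤ γ))

  naming-explosive : ∀ {φ} → ⟦ h ⟧ φ ∉ Tr → ⟦ naming h ψ χ ⟧ φ ∈ Δ → Δ ⊨ χ
  naming-explosive {φ} hφ∉Tr σφ∈Δ g gΔ⊆Tr with naming-value h ψ χ g (gΔ⊆Tr (ψ , ψ∈Δ , refl))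
  ... | inj₁ gχ≡⊤ = inj₁ (sym gχ≡⊤)
  ... | inj₂ gσ≗h = ⊥-elim (hφ∉Tr (subst Tr (gσ≗h φ) (gΔ⊆Tr (_ , σφ∈Δ , refl))))

module _ (𝓛 : Logic ℓ) (𝓛-extends : 𝓛 Extends 𝓛𝓑) where

  open Logic 𝓛

  refutable⇒explosive : ∀ {Γ φ} → Γ ⊢ φ → (h : Hom 𝐅𝐦 𝓕𝓞𝓤𝓡) → ⟦ h ⟧ [ Γ ] ⊆ Tr →
                        ⟦ h ⟧ φ ∉ Tr → ∀ ψ χ → (λ ξ → Lift ℓ (ξ ∈ ｛ ψ ｝)) ⊢ χ
  refutable⇒explosive {Γ} {φ} Γ⊢φ h hΓ⊆Tr hφ∉Tr ψ χ =
    -- Here `Δ` is `Cn Ψ`, which contains both `ψ` and the substituted `φ`; idempotence then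
    -- collapses `Cn (Cn Ψ)`.
    idempotent (𝓛-extends _ χ (naming-explosive h ψ χ (extensive (lift refl)) hφ∉Tr ⊢σφ))
    where
    Ψ : Pred Fm ℓ
    Ψ ξ = Lift ℓ (ξ ∈ ｛ ψ ｝)

    ⊢σΓ : ⟦ naming h ψ χ ⟧ [ Γ ] ⊆ Cn Ψ
    ⊢σΓ (γ , γ∈Γ , refl) =
      𝓛-extends Ψ _ (naming-sound h ψ χ (lift refl) (hΓ⊆Tr (γ , γ∈Γ , refl)))

    ⊢σφ : Ψ ⊢ ⟦ naming h ψ χ ⟧ φ
    -- Cut for a whole set of premises: structurality derives the instance of `φ` from the image of
    -- `Γ`, and `⊢σΓ` places that image inside `Cn Ψ`.
    ⊢σφ = idempotent (monotone ⊢σΓ (structural (naming h ψ χ) (φ , Γ⊢φ , refl)))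

proposition3p3p2 : ∀ {ℓ : Level} (𝓛 : Logic ℓ) →
    Consistent 𝓛 →
    𝓛 Extends 𝓛𝓑 →
    let open Logic 𝓛 in
    ∀ (Γ : Pred Fm ℓ) (φ : Fm) → Γ ⊢ φ ⇔ Γ ⊨ φ
proposition3p3p2 𝓛 (ψ , χ , ψ⊬χ) 𝓛-extends Γ φ = mk⇔ sound (𝓛-extends Γ φ)
  where
  open Logic 𝓛

  sound : Γ ⊢ φ → Γ ⊨ φ
  -- Consistency only yields a contradiction, so deciding `Tr` is what makes the refutation of
  -- `hφ∉Tr` give membership constructively.
  sound Γ⊢φ h hΓ⊆Tr with Tr? (⟦ h ⟧ φ)
  ... | yes hφ∈Tr = hφ∈Tr
  ... | no  hφ∉Tr =
    ⊥-elim (ψ⊬χ (refutable⇒explosive 𝓛 𝓛-extends Γ⊢φ h hΓ⊆Tr hφ∉Tr ψ χ))
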